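{- Let $(X,*,0)$ be a solid weak BCC-algebra and define $x\wedge y=y*(y*x)$. Then the following are equivalent: (1) $X$ is branchwise commutative; (2) for each $a\in I(X)$, the branch $B(a)$ is a semilattice with respect to the operation $\wedge$; (3) $A(x)\cap A(y)=A(x\wedge y)$ for all $x,y$ belonging to the same branch.
   Context: A weak BCC-algebra is a set $X$ with a binary operation $*$ and a constant $0$ satisfying, for all $x,y,z\in X$: (i) $((x*y)*(z*y))*(x*z)=0$; (ii) $x*x=0$; (iii) $x*0=x$; (iv) $x*y=y*x=0$ implies $x=y$. The relation $x\leqslant y$ iff $x*y=0$ is a partial order on $X$. Let $I(X)$ be the set of minimal elements of $X$ with respect to $\leqslant$. For $a\in I(X)$ the branch initiated by $a$ is $B(a)=\{x\in X: a\leqslant x\}$; "belonging to the same branch" means lying in a common $B(a)$. For $b\in X$, the initial part is $A(b)=\{x\in X: x\leqslant b\}$. A weak BCC-algebra is called (left) solid if $(x*y)*z=(x*z)*y$ holds for all $x,y$ belonging to the same branch and all $z\in X$. It is called branchwise commutative if $x*(x*y)=y*(y*x)$ holds for all $x,y$ belonging to the same branch. -}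

module Defs where

open import Level using (Level; _⊔_; suc)
open import Algebra.Core using (Op₂)
open import Algebra.Structures using (IsMagma)
open import Algebra.Lattice.Structures using (IsSemilattice)
open import Data.Product using (∃; ∃-syntax; _×_; _,_; proj₁; proj₂)
open import Function using (_on_)
open import Relation.Binary.Core using (Rel)
open import Relation.Unary using (Pred; _∩_; _≐_)

-- As for the library's algebraic structures, the equality of the carrier is
-- an equivalence relation _≈_ respected by the operation.
record WeakBCCAlgebra (c ℓ : Level) : Set (suc (c ⊔ ℓ)) where
  infixl 7 _*_
  infix  4 _≈_
  field
    Carrier : Set c
    _≈_     : Rel Carrier ℓ
    _*_     : Op₂ Carrier
    0#      : Carrier
    isMagma : IsMagma _≈_ _*_
    bcc     : ∀ x y z → ((x * y) * (z * y)) * (x * z) ≈ 0#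
    *-self  : ∀ x → x * x ≈ 0#
    *-zeroʳ : ∀ x → x * 0# ≈ x
    antisym : ∀ {x y} → x * y ≈ 0# → y * x ≈ 0# → x ≈ y

  open IsMagma isMagma public

module _ {c ℓ : Level} (X : WeakBCCAlgebra c ℓ) where
  open WeakBCCAlgebra X

  infix 4 _≤_
  _≤_ : Rel Carrier ℓ
  x ≤ y = x * y ≈ 0#

  I : Pred Carrier (c ⊔ ℓ)
  I a = ∀ x → x ≤ a → x ≈ a

  -- B a is called a branch only when I a holds.
  B : Carrier → Pred Carrier ℓ
  B a x = a ≤ x

  SameBranch : Rel Carrier (c ⊔ ℓ)
  SameBranch x y = ∃[ a ] I a × B a x × B a y

  A : Carrier → Pred Carrier ℓ
  A b x = x ≤ b

  Solid : Set (c ⊔ ℓ)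
  Solid = ∀ x y z → SameBranch x y → (x * y) * z ≈ (x * z) * y

  BranchwiseCommutative : Set (c ⊔ ℓ)
  BranchwiseCommutative = ∀ x y → SameBranch x y → x * (x * y) ≈ y * (y * x)

  infixr 7 _∧_
  _∧_ : Op₂ Carrier
  x ∧ y = y * (y * x)

  -- A subset P is a semilattice under ∧ when it is closed under ∧ and the
  -- restriction of ∧ to P, with the equality inherited from the carrier,
  -- satisfies the semilattice laws.
  record IsSemilatticeOn {p} (P : Pred Carrier p) : Set (c ⊔ ℓ ⊔ p) where
    field
      ∧-closed : ∀ {x y} → P x → P y → P (x ∧ y)

    _∧ᴾ_ : Op₂ (∃ P)
    (x , px) ∧ᴾ (y , py) = x ∧ y , ∧-closed px py

    field
      isSemilattice : IsSemilattice (_≈_ on proj₁) _∧ᴾ_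

  BranchesAreSemilattices : Set (c ⊔ ℓ)
  BranchesAreSemilattices = ∀ a → I a → IsSemilatticeOn (B a)

  InitialPartsMeet : Set (c ⊔ ℓ)
  InitialPartsMeet = ∀ x y → SameBranch x y → (A x ∩ A y) ≐ A (x ∧ y)

{-# OPTIONS --safe #-}

-- Write φ x = 0 * (0 * x). Then φ x ≤ x, and the law (0 * y) * (x * y) ≈ 0 * x
-- shows that x ≤ y forces 0 * x ≈ 0 * y, hence φ x ≈ φ y; so whatever lies
-- below an element of the branch of a lies in that branch itself. In the solid
-- case y * (y * x) is a lower bound of x and y in their branch, and
-- commutativity makes it the greatest one: if z ≤ x and z ≤ y then
-- z ≈ z * (z * y) ≈ y * (y * z) ≤ y * (y * x). Conversely each of the other two
-- conditions determines x ∧ y symmetrically in x and y.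
module Submission where

open import Defs
open import Level using (Level)
open import Algebra.Lattice.Structures using (IsSemilattice)
open import Data.Product using (∃; _×_; _,_; proj₁; proj₂; swap)
open import Function using (_on_)
open import Function.Bundles using (_⇔_; mk⇔)
open import Relation.Binary.Bundles using (Poset)
open import Relation.Binary.Lattice.Bundles using (MeetSemilattice)
open import Relation.Binary.Structures using (IsPartialOrder)
import Relation.Binary.Construct.On as On
import Relation.Binary.Lattice.Properties.MeetSemilattice as MeetSemilatticeProperties
import Relation.Binary.Reasoning.PartialOrder as PosetReasoning

module WeakBCCProperties {c ℓ : Level} (X : WeakBCCAlgebra c ℓ) where
  open WeakBCCAlgebra X hiding (antisym)
  private
    infix 4 _⊑_
    _⊑_ = _≤_ X
    infixr 7 _⊓_
    _⊓_ = _∧_ X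

  -- When `x * y ≈ 0#`, the last factor of `bcc x z y` vanishes by `*-zeroʳ`, leaving the claim. The
  -- antitone law below cancels the inner factor `x * y` of `bcc z y x` instead.
  *-monoˡ-≤ : ∀ {x y} z → x ⊑ y → x * z ⊑ y * z
  *-monoˡ-≤ {x} {y} z x≤y = trans (sym (*-zeroʳ _))
    (trans (∙-cong refl (sym x≤y)) (bcc x z y))

  *-monoʳ-≤ : ∀ {x y} z → x ⊑ y → z * y ⊑ z * x
  *-monoʳ-≤ {x} {y} z x≤y = trans
    (∙-cong (trans (sym (*-zeroʳ _)) (∙-cong refl (sym x≤y))) refl)
    (bcc z y x)

  ≤0⇒≈0 : ∀ {x} → x ⊑ 0# → x ≈ 0#
  ≤0⇒≈0 x≤0 = trans (sym (*-zeroʳ _)) x≤0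

  ≤-trans : ∀ {x y z} → x ⊑ y → y ⊑ z → x ⊑ z
  ≤-trans {z = z} x≤y y≤z = ≤0⇒≈0 (trans (∙-cong refl (sym y≤z)) (*-monoˡ-≤ z x≤y))

  ≤-isPartialOrder : IsPartialOrder _≈_ _⊑_
  ≤-isPartialOrder = record
    { isPreorder = record
      { isEquivalence = isEquivalence
      ; reflexive     = λ x≈y → trans (∙-cong x≈y refl) (*-self _)
      ; trans         = ≤-trans
      }
    ; antisym = WeakBCCAlgebra.antisym X
    }

  ≤-poset : Poset c ℓ ℓ
  ≤-poset = record { isPartialOrder = ≤-isPartialOrder }

  open Poset ≤-poset using (antisym) renaming (refl to ≤-refl; reflexive to ≤-reflexive)
  open PosetReasoning ≤-poset

  0*[x*y]≤y*x : ∀ x y → 0# * (x * y) ⊑ y * x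
  0*[x*y]≤y*x x y = begin
    0# * (x * y)      ≈⟨ ∙-cong (*-self y) refl ⟨
    (y * y) * (x * y) ≤⟨ bcc y y x ⟩
    y * x             ∎

  -- This turns out to be the minimal element below `x`, so a branch is a fibre of `φ`.
  φ : Carrier → Carrier
  φ x = 0# * (0# * x)

  φ≤id : ∀ x → φ x ⊑ x
  φ≤id x = ≤-trans (0*[x*y]≤y*x 0# x) (≤-reflexive (*-zeroʳ x))

  -- One inequality is an axiom. For the other, the antitone map `0# *_` is applied to
  -- `(y * x) * (0# * x) ⊑ y`, and `0*[x*y]≤y*x` then exchanges the two factors.
  [0*x]*[y*x]≈0*y : ∀ x y → (0# * x) * (y * x) ≈ 0# * y
  [0*x]*[y*x]≈0*y x y = antisym (bcc 0# x y) (begin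
    0# * y                    ≈⟨ ∙-cong refl (*-zeroʳ y) ⟨
    0# * (y * 0#)             ≤⟨ *-monoʳ-≤ 0# (bcc y x 0#) ⟩
    0# * ((y * x) * (0# * x)) ≤⟨ 0*[x*y]≤y*x _ _ ⟩
    (0# * x) * (y * x)        ∎)

  ≤⇒0*≈0* : ∀ {x y} → x ⊑ y → 0# * x ≈ 0# * y
  ≤⇒0*≈0* {x} {y} x≤y = begin-equality
    0# * x             ≈⟨ [0*x]*[y*x]≈0*y y x ⟨
    (0# * y) * (x * y) ≈⟨ ∙-cong refl x≤y ⟩
    (0# * y) * 0#      ≈⟨ *-zeroʳ _ ⟩
    0# * y             ∎

  B-downClosed : ∀ {a x z} → I X a → B X a x → z ⊑ x → B X a z
  B-downClosed {a} {x} {z} minimal a≤x z≤x = begin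
    -- Minimality makes `a` a fixed point of `φ`.
    a   ≈⟨ minimal (φ a) (φ≤id a) ⟨
    φ a ≈⟨ ∙-cong refl (trans (≤⇒0*≈0* a≤x) (sym (≤⇒0*≈0* z≤x))) ⟩
    φ z ≤⟨ φ≤id z ⟩
    z   ∎

  SameBranch-sym : ∀ {x y} → SameBranch X x y → SameBranch X y x
  SameBranch-sym (a , minimal , a≤x , a≤y) = a , minimal , a≤y , a≤x

  -- From `a ⊑ y` follows `x * y ⊑ x * a`, and `0# *_` is constant along `⊑`; so `y` may be replaced
  -- by `a`.
  SameBranch⇒0≤* : ∀ {x y} → SameBranch X x y → 0# ⊑ x * y
  SameBranch⇒0≤* {x} {y} (a , minimal , a≤x , a≤y) = begin-equality
    0# * (x * y)      ≈⟨ ≤⇒0*≈0* (*-monoʳ-≤ x a≤y) ⟩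
    0# * (x * a)      ≈⟨ ∙-cong (*-self a) refl ⟨
    (a * a) * (x * a) ≈⟨ *-monoˡ-≤ a a≤x ⟩
    0#                ∎

  module _ (solid : Solid X) where

    x∧y≤x : ∀ {x y} → SameBranch X x y → x ⊓ y ⊑ x
    x∧y≤x {x} {y} xy =
      trans (sym (solid y x (y * x) (SameBranch-sym xy))) (*-self (y * x))

    x∧y≤y : ∀ {x y} → SameBranch X x y → x ⊓ y ⊑ y
    x∧y≤y {x} {y} xy@(a , minimal , _ , a≤y) = begin-equality
      y * (y * x) * y ≈⟨ solid y y (y * x) (a , minimal , a≤y , a≤y) ⟨
      y * y * (y * x) ≈⟨ ∙-cong (*-self y) refl ⟩
      0# * (y * x)    ≈⟨ SameBranch⇒0≤* (SameBranch-sym xy) ⟩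
      0#              ∎

    module _ (comm : BranchwiseCommutative X) where

      ∧-greatest : ∀ {x y z} → SameBranch X x y → z ⊑ x → z ⊑ y → z ⊑ x ⊓ y
      ∧-greatest {x} {y} {z} (a , minimal , a≤x , a≤y) z≤x z≤y = begin
        z           ≈⟨ *-zeroʳ z ⟨
        z * 0#      ≈⟨ ∙-cong refl z≤y ⟨
        -- Down-closure puts `z` in the branch of `y`, which commutativity requires.
        z * (z * y) ≈⟨ comm z y (a , minimal , B-downClosed minimal a≤x z≤x , a≤y) ⟩
        y * (y * z) ≤⟨ *-monoʳ-≤ y (*-monoʳ-≤ y z≤x) ⟩
        y * (y * x) ∎

      comm⇒semilattices : BranchesAreSemilattices X
      comm⇒semilattices a minimal = record
        { ∧-closed      = ∧-closed
        ; isSemilattice = MeetSemilatticeProperties.isAlgSemilattice meetSemilattice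
        }
        where
        ∧-closed : ∀ {x y} → B X a x → B X a y → B X a (x ⊓ y)
        ∧-closed a≤x a≤y = B-downClosed minimal a≤x (x∧y≤x (a , minimal , a≤x , a≤y))

        -- The algebraic laws all follow from `⊓` being the infimum in the order restricted to the
        -- branch.
        meetSemilattice : MeetSemilattice _ _ _
        meetSemilattice = record
          { Carrier = ∃ (B X a)
          ; _≈_     = _≈_ on proj₁
          ; _≤_     = _⊑_ on proj₁
          ; _∧_     = λ (x , a≤x) (y , a≤y) → x ⊓ y , ∧-closed a≤x a≤y
          ; isMeetSemilattice = record
            { isPartialOrder = On.isPartialOrder proj₁ ≤-isPartialOrder
            ; infimum        = λ (x , a≤x) (y , a≤y) →
                let xy = a , minimal , a≤x , a≤y
                in x∧y≤x xy , x∧y≤y xy , λ _ → ∧-greatest xy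
            }
          }

      comm⇒initialPartsMeet : InitialPartsMeet X
      comm⇒initialPartsMeet x y xy =
        (λ (z≤x , z≤y) → ∧-greatest xy z≤x z≤y) ,
        (λ z≤x∧y → ≤-trans z≤x∧y (x∧y≤x xy) , ≤-trans z≤x∧y (x∧y≤y xy))

  semilattices⇒comm : BranchesAreSemilattices X → BranchwiseCommutative X
  semilattices⇒comm semilattices x y (a , minimal , a≤x , a≤y) =
    -- The arguments are swapped because `y ⊓ x` unfolds to `x * (x * y)`.
    IsSemilattice.comm isSemilattice (y , a≤y) (x , a≤x)
    where open IsSemilatticeOn (semilattices a minimal)

  initialPartsMeet⇒comm : InitialPartsMeet X → BranchwiseCommutative X
  initialPartsMeet⇒comm meet x y xy =
    antisym (x∧y≤y∧x (SameBranch-sym xy)) (x∧y≤y∧x xy)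
    where
    x∧y≤y∧x : ∀ {x y} → SameBranch X x y → x ⊓ y ⊑ y ⊓ x
    -- By reflexivity `x ⊓ y` lies in its own initial part, hence below both `x` and `y`; exchanging
    -- these two bounds puts it in the initial part of `y ⊓ x`.
    x∧y≤y∧x xy = proj₁ (meet _ _ (SameBranch-sym xy))
      (swap (proj₂ (meet _ _ xy) ≤-refl))

theorem3p7 : ∀ {c ℓ : Level} (X : WeakBCCAlgebra c ℓ) → Solid X →
    (BranchwiseCommutative X ⇔ BranchesAreSemilattices X) ×
    (BranchesAreSemilattices X ⇔ InitialPartsMeet X)
theorem3p7 X solid =
  mk⇔ (comm⇒semilattices solid) semilattices⇒comm ,
  mk⇔ (λ semilattices → comm⇒initialPartsMeet solid (semilattices⇒comm semilattices))
      (λ meet → comm⇒semilattices solid (initialPartsMeet⇒comm meet))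
  where open WeakBCCProperties X
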